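{- For every $\delta>0$ there exist instances $\mathcal{I}$ of the oblivious knapsack problem for which no policy (universal or not) achieves a robustness factor of $2-\delta$.
   Context: An instance of the oblivious knapsack problem is a finite set $\mathcal{I}$ of $n$ items; each item $i$ has a value $v(i)\in\mathbb{Q}_{\ge 0}$ and a size $l(i)\in\mathbb{Q}_{>0}$. For $S\subseteq\mathcal{I}$ put $v(S)=\sum_{i\in S}v(i)$ and $l(S)=\sum_{i\in S}l(i)$. For a capacity $C\geq 0$, $\textsc{Opt}(\mathcal{I},C)$ denotes a subset $S\subseteq\mathcal{I}$ with $l(S)\le C$ of maximum value. A policy $\mathcal{P}$ for $\mathcal{I}$ is a binary decision tree whose nodes are labeled by items and that contains every item exactly once along each path from the root to a leaf; it does not depend on the capacity. Its packing $\mathcal{P}(C)\subseteq\mathcal{I}$ for capacity $C$ is obtained as follows: start with $\mathcal{P}(C)=\emptyset$ at the root; at a node with item $r$, if $l(r)+l(\mathcal{P}(C))\le C$, add $r$ to $\mathcal{P}(C)$ and continue with the left subtree; otherwise discard $r$ and continue with the right subtree. The policy $\mathcal{P}$ achieves robustness factor $\alpha$ (is $\alpha$-robust) if $v(\textsc{Opt}(\mathcal{I},C))\le\alpha\, v(\mathcal{P}(C))$ for all capacities $C$. A universal policy is one in which every root-to-leaf path carries the same permutation of the items. -}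

module Defs where

import Algebra.Properties.CommutativeMonoid.Sum
open import Data.Bool.Base using (true; false; if_then_else_)
open import Data.Fin.Base using (Fin)
open import Data.Fin.Subset using (Subset; inside; outside; ⊥; ⁅_⁆; _∪_)
open import Data.List.Base using (List; []; _∷_; _++_; map)
open import Data.List.Membership.Propositional using (_∈_)
open import Data.List.Relation.Unary.Unique.Propositional using (Unique)
open import Data.Nat.Base using (ℕ; zero; suc)
open import Data.Product.Base using (∃-syntax; _×_; _,_)
open import Data.Rational.Base using (ℚ; 0ℚ; _+_; _*_; _≤_; _<_)
open import Data.Rational.Properties
  using (_≤?_; ≤-refl; ≤-trans; ≤-total; ≤-reflexive; +-0-commutativeMonoid)
open import Data.Sum.Base using (_⊎_; inj₁; inj₂)
open import Data.Vec.Base as Vec using (lookup)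
open import Relation.Binary.PropositionalEquality using (_≡_; trans; cong)
open import Relation.Nullary using (¬_; yes; no; does; contradiction)
open import Relation.Unary using (Decidable)

open Algebra.Properties.CommutativeMonoid.Sum +-0-commutativeMonoid
  using (sum; sum-cong-≗; sum-replicate-zero)

total : ∀ {n} → (Fin n → ℚ) → Subset n → ℚ
total f S = sum (λ i → if lookup S i then f i else 0ℚ)

record Instance : Set where
  field
    n                 : ℕ
    value             : Fin n → ℚ
    size              : Fin n → ℚ
    value-nonNegative : ∀ i → 0ℚ ≤ value i
    size-positive     : ∀ i → 0ℚ < size i

  v : Subset n → ℚ
  v = total value

  l : Subset n → ℚ
  l = total size

-- Items label the internal nodes only; a leaf marks the point where no item is
-- left to try.  The first subtree is taken when the item is packed.
data Tree (n : ℕ) : Set where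
  leaf : Tree n
  node : (r : Fin n) (left right : Tree n) → Tree n

paths : ∀ {n} → Tree n → List (List (Fin n))
paths leaf         = [] ∷ []
paths (node r s t) = map (r ∷_) (paths s ++ paths t)

record Policy (n : ℕ) : Set where
  field
    tree          : Tree n
    at-least-once : ∀ {p} → p ∈ paths tree → ∀ i → i ∈ p
    at-most-once  : ∀ {p} → p ∈ paths tree → Unique p

module _ (I : Instance) where
  open Instance I

  -- The accumulator is the set of items packed so far.
  packFrom : ℚ → Subset n → Tree n → Subset n
  packFrom C S leaf = S
  packFrom C S (node r s t) =
    if does (size r + l S ≤? C)
    then packFrom C (S ∪ ⁅ r ⁆) s
    else packFrom C S t

  packing : Policy n → ℚ → Subset n
  packing P C = packFrom C ⊥ (Policy.tree P)

  -- Optimal solutions need not be unique, hence a relation; they all have the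
  -- same value, and optimum below shows that one exists.
  IsOpt : ℚ → Subset n → Set
  IsOpt C S = l S ≤ C × (∀ T → l T ≤ C → v T ≤ v S)

  -- Rational factors and capacities lose nothing over real ones: packings and
  -- optima change only at capacities that are sums of (rational) sizes, and
  -- an α-robust policy is also β-robust for every β ≥ α.
  Robust : ℚ → Policy n → Set
  Robust α P = ∀ C → 0ℚ ≤ C → ∀ S → IsOpt C S → v S ≤ α * v (packing P C)

private
  maximiser : ∀ {n} {F : Subset n → Set} (F? : Decidable F) (f : Subset n → ℚ) →
              (∃[ S ] F S × (∀ T → F T → f T ≤ f S)) ⊎ (∀ S → ¬ F S)
  maximiser {zero} F? f with F? Vec.[]
  ... | yes p = inj₁ (Vec.[] , p , λ { Vec.[] _ → ≤-refl })
  ... | no ¬p = inj₂ λ { Vec.[] → ¬p }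
  maximiser {suc n} F? f
    with maximiser (λ S → F? (inside Vec.∷ S)) (λ S → f (inside Vec.∷ S))
       | maximiser (λ S → F? (outside Vec.∷ S)) (λ S → f (outside Vec.∷ S))
  ... | inj₂ a | inj₂ b =
    inj₂ λ { (true Vec.∷ S) → a S ; (false Vec.∷ S) → b S }
  ... | inj₁ (S , p , m) | inj₂ b =
    inj₁ (_ , p , λ { (true Vec.∷ T) q → m T q
                    ; (false Vec.∷ T) q → contradiction q (b T) })
  ... | inj₂ a | inj₁ (S , p , m) =
    inj₁ (_ , p , λ { (true Vec.∷ T) q → contradiction q (a T)
                    ; (false Vec.∷ T) q → m T q })
  ... | inj₁ (S , p , m) | inj₁ (S′ , p′ , m′)
    with ≤-total (f (inside Vec.∷ S)) (f (outside Vec.∷ S′))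
  ... | inj₁ le = inj₁ (_ , p′ , λ { (true Vec.∷ T) q → ≤-trans (m T q) le
                                   ; (false Vec.∷ T) q → m′ T q })
  ... | inj₂ ge = inj₁ (_ , p , λ { (true Vec.∷ T) q → m T q
                                  ; (false Vec.∷ T) q → ≤-trans (m′ T q) ge })

total-⊥ : ∀ {n} (f : Fin n → ℚ) → total f ⊥ ≡ 0ℚ
total-⊥ {n} f =
  trans (sum-cong-≗ (λ i → cong (if_then f i else 0ℚ) (lookup-replicate i outside)))
        (sum-replicate-zero n)
  where open import Data.Vec.Properties using (lookup-replicate)

optimum : ∀ I C → 0ℚ ≤ C → ∃[ S ] IsOpt I C S
optimum I C 0≤C with maximiser (λ S → Instance.l I S ≤? C) (Instance.v I)
... | inj₁ opt  = opt
... | inj₂ none =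
  contradiction (≤-trans (≤-reflexive (total-⊥ (Instance.size I))) 0≤C) (none ⊥)

{-# OPTIONS --safe #-}
-- Give item i = 0, …, n−1 the size 2ⁿ + 2ⁱ and the value n + i.  Since
-- 2ʳ⁻¹ + 2ʳ⁻² < 2ʳ, at the capacity of the pair {r−1, r−2} a policy whose root
-- is r packs r alone, while the pair is worth 2(n + r) − 3.  For r ≤ 1 the
-- capacity of the last item alone, whose value is at least 2(n + r) − 3, also
-- leaves room for r only.  Hence every policy loses a factor of at least 2 − 3/n.
module Submission where

open import Defs
open import Data.Fin.Base using (Fin; zero; suc; toℕ; fromℕ; inject₁)
open import Data.Fin.Properties using (toℕ-inject₁; toℕ-fromℕ; toℕ≤pred[n])
open import Data.Fin.Subset using (Subset; ⊥; ⁅_⁆; _∪_)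
open import Data.Fin.Subset.Properties using (∪-identityˡ; ∪-identityʳ)
open import Data.Integer.Base as ℤ using (+_; -[1+_]; +<+; +≤+)
import Data.Integer.Properties as ℤ
open import Data.List.Base using (_∷_)
open import Data.List.Membership.Propositional using (_∈_)
open import Data.List.Membership.Propositional.Properties using (∈-map⁺; ∈-++⁺ˡ; ∈-++⁺ʳ)
open import Data.List.Relation.Unary.All using () renaming (lookup to All-lookup)
open import Data.List.Relation.Unary.AllPairs using (_∷_)
open import Data.List.Relation.Unary.Any using (here; there)
open import Data.List.Relation.Unary.Unique.Propositional using (Unique)
open import Data.Nat.Base as ℕ using (ℕ; suc; s≤s; _^_)
open import Data.Nat.Coprimality using (1-coprimeTo) renaming (sym to coprime-sym)
import Data.Nat.Properties as ℕ
open import Data.Nat.Solver using (module +-*-Solver)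
open import Data.Product.Base using (Σ-syntax; ∃-syntax; _,_; proj₂)
open import Data.Rational.Base
  using (ℚ; mkℚ; 0ℚ; _+_; _*_; _≤_; _<_; _-_; _/_; *<*; *≤*)
open import Data.Rational.Properties as ℚ using (_≤?_)
import Data.Rational.Solver as ℚ
open import Data.Rational.Unnormalised.Base using (*≡*; *<*)
import Data.Rational.Unnormalised.Properties as ℚᵘ
open import Function.Base using (_∘_)
open import Relation.Binary.PropositionalEquality
  using (_≡_; _≢_; refl; sym; trans; cong; cong₂; subst; subst₂)
open import Relation.Nullary using (¬_; contradiction)
open import Relation.Nullary.Decidable using (dec-true; dec-false)

-- Given directly in lowest terms, so that numerator and denominator compute for a variable `m`;
-- `+ m / 1` would be stuck on a gcd.
fromNat : ℕ → ℚ
fromNat m = mkℚ (+ m) 0 (coprime-sym (1-coprimeTo m))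

fromNat-mono-≤ : ∀ {a b} → a ℕ.≤ b → fromNat a ≤ fromNat b
fromNat-mono-≤ a≤b = *≤* (ℤ.*-monoʳ-≤-nonNeg (+ 1) (+≤+ a≤b))

fromNat-mono-< : ∀ {a b} → a ℕ.< b → fromNat a < fromNat b
fromNat-mono-< a<b = *<* (ℤ.*-monoʳ-<-pos (+ 1) (+<+ a<b))

fromNat-homo-+ : ∀ a b → fromNat (a ℕ.+ b) ≡ fromNat a + fromNat b
fromNat-homo-+ a b = ℚ.toℚᵘ-injective (ℚᵘ.≃-trans
  (*≡* (cong (ℤ._* + 1) (sym (cong₂ ℤ._+_ (ℤ.*-identityʳ (+ a)) (ℤ.*-identityʳ (+ b))))))
  (ℚᵘ.≃-sym (ℚ.toℚᵘ-homo-+ (fromNat a) (fromNat b))))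

-- The bound covers all `w` from `N` on, because it is applied to the value of a root item that is
-- known only after `N` has fixed the instance.
archimedean : ∀ δ → 0ℚ < δ → ∀ m → ∃[ N ] (∀ w → N ℕ.≤ w → fromNat m < δ * fromNat w)
archimedean (mkℚ (+ 0) d-1 _) (*<* (+<+ ())) m
-- The numerator of `δ` is at least 1, so it suffices that `w` exceeds `m` times the denominator
-- `suc d-1`.
archimedean δ@(mkℚ (+ suc p) d-1 _) _ m = suc (m ℕ.* suc d-1) , λ w N≤w →
  ℚ.toℚᵘ-cancel-< (ℚᵘ.<-respʳ-≃ (ℚᵘ.≃-sym (ℚ.toℚᵘ-homo-* δ (fromNat w)))
    (*<* (subst₂ ℤ._<_ (ℤ.pos-* m (suc d-1 ℕ.* 1))
                       (trans (ℤ.pos-* (suc p ℕ.* w) 1) (cong (ℤ._* + 1) (ℤ.pos-* (suc p) w)))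
      (+<+ (begin-strict
        m ℕ.* (suc d-1 ℕ.* 1)   ≡⟨ cong (m ℕ.*_) (ℕ.*-identityʳ (suc d-1)) ⟩
        m ℕ.* suc d-1           <⟨ N≤w ⟩
        w                       ≤⟨ ℕ.m≤m+n w (p ℕ.* w) ⟩
        suc p ℕ.* w             ≡⟨ ℕ.*-identityʳ (suc p ℕ.* w) ⟨
        suc p ℕ.* w ℕ.* 1       ∎)))))
  where open ℕ.≤-Reasoning
archimedean (mkℚ -[1+ _ ] _ _) (*<* ()) m

total-⁅⁆ : ∀ {n} (f : Fin n → ℚ) i → total f ⁅ i ⁆ ≡ f i
total-⁅⁆ f zero    = trans (cong (λ x → f zero + x) (total-⊥ (f ∘ suc))) (ℚ.+-identityʳ (f zero))
total-⁅⁆ f (suc i) = trans (ℚ.+-identityˡ _) (total-⁅⁆ (f ∘ suc) i)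

total-⁅⁆∪⁅⁆ : ∀ {n} (f : Fin n → ℚ) {i j} → i ≢ j → total f (⁅ i ⁆ ∪ ⁅ j ⁆) ≡ f i + f j
total-⁅⁆∪⁅⁆ f {zero} {zero} i≢j = contradiction refl i≢j
total-⁅⁆∪⁅⁆ f {zero} {suc j} _ = cong (λ x → f zero + x)
  (trans (cong (total (f ∘ suc)) (∪-identityˡ ⁅ j ⁆)) (total-⁅⁆ (f ∘ suc) j))
total-⁅⁆∪⁅⁆ f {suc i} {zero} _ = trans
  (cong (λ x → f zero + x) (trans (cong (total (f ∘ suc)) (∪-identityʳ ⁅ i ⁆)) (total-⁅⁆ (f ∘ suc) i)))
  (ℚ.+-comm (f zero) (f (suc i)))
total-⁅⁆∪⁅⁆ f {suc i} {suc j} i≢j =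
  trans (ℚ.+-identityˡ _) (total-⁅⁆∪⁅⁆ (f ∘ suc) (i≢j ∘ cong suc))

-- Makes hypotheses about paths usable at a node: they reach its item only through some path that
-- starts there.
path : ∀ {n} (t : Tree n) → ∃[ p ] p ∈ paths t
path leaf = _ , here refl
path (node r s t) = _ , ∈-map⁺ (r ∷_) (∈-++⁺ˡ (proj₂ (path s)))

module _ (I : Instance) where
  open Instance I

  -- Each node discards its item and leaves `S` as it was, so the hypothesis passes on to the right
  -- subtree.
  packFrom-full : ∀ {C S} t → (∀ {p} → p ∈ paths t → ∀ {j} → j ∈ p → C < size j + l S) →
                  packFrom I C S t ≡ S
  packFrom-full leaf _ = refl
  packFrom-full {C} {S} (node r s t) full
    rewrite dec-false (size r + l S ≤? C)
              (ℚ.<-irrefl refl ∘ ℚ.<-≤-trans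
                (full (∈-map⁺ (r ∷_) (∈-++⁺ˡ (proj₂ (path s)))) (here refl)))
    = packFrom-full t λ p∈t j∈p → full (∈-map⁺ (r ∷_) (∈-++⁺ʳ (paths s) p∈t)) (there j∈p)

  -- `r` is chosen before `C`: the first item tried is the same for all capacities, so the capacity
  -- may be picked against it. The argument in `Fin n` rules out a bare leaf, whose empty path
  -- covers no item.
  packing-root : Fin n → (P : Policy n) →
                 ∃[ r ] (∀ C → size r ≤ C → (∀ j → j ≢ r → C < size j + size r) →
                         packing I P C ≡ ⁅ r ⁆)
  packing-root i record { tree = leaf ; at-least-once = covers } with covers (here refl) i
  ... | ()
  packing-root i record { tree = node r s t ; at-most-once = unique } = r , packs
    where
    packs : ∀ C → size r ≤ C → (∀ j → j ≢ r → C < size j + size r) →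
            packFrom I C ⊥ (node r s t) ≡ ⁅ r ⁆
    packs C fits others
      rewrite dec-true (size r + l ⊥ ≤? C)
                (subst (_≤ C) (sym (trans (cong (λ x → size r + x) (total-⊥ size)) (ℚ.+-identityʳ (size r)))) fits)
            | ∪-identityˡ ⁅ r ⁆
      = packFrom-full s λ p∈s {j} j∈p → subst (λ x → C < size j + x) (sym (total-⁅⁆ size r))
          -- No path repeats an item, so an item met below the root differs from `r`.
          (others j λ { refl → r∉ (unique (∈-map⁺ (r ∷_) (∈-++⁺ˡ p∈s))) j∈p })
      where
      r∉ : ∀ {p} → Unique (r ∷ p) → ¬ r ∈ p
      r∉ (r≢ ∷ _) r∈p = All-lookup r≢ r∈p refl

  -- Some optimum exists and is worth at least as much as any feasible `T`, so it need not be
  -- identified.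
  robust-bound : ∀ {α P r C} T → Robust I α P → 0ℚ ≤ C → packing I P C ≡ ⁅ r ⁆ →
                 l T ≤ C → v T ≤ α * value r
  robust-bound {α} {P} {r} {C} T robust 0≤C packs T≤C with optimum I C 0≤C
  ... | S , opt@(_ , best) = ℚ.≤-trans (best T T≤C)
    (subst (λ x → v S ≤ α * x) (trans (cong v packs) (total-⁅⁆ value r)) (robust C 0≤C S opt))

-- With `u` the rival's value and `w` the root's: 2w ≤ u + 3 < u + δw ≤ (2 - δ)w + δw = 2w.
no-factor : ∀ δ u w → u ℕ.+ 3 ℕ.≥ w ℕ.+ w → fromNat 3 < δ * fromNat w →
            ¬ fromNat u ≤ (+ 2 / 1 - δ) * fromNat w
no-factor δ u w 2w≤u+3 3<δw u≤ = ℚ.<-irrefl refl (begin-strict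
  fromNat u + fromNat 3        <⟨ ℚ.+-monoʳ-< (fromNat u) 3<δw ⟩
  fromNat u + δ * fromNat w    ≤⟨ ℚ.+-monoˡ-≤ (δ * fromNat w) u≤ ⟩
  (+ 2 / 1 - δ) * fromNat w + δ * fromNat w
    ≡⟨ solve 2 (λ d x → (con (+ 2 / 1) :- d) :* x :+ d :* x := x :+ x) refl δ (fromNat w) ⟩
  fromNat w + fromNat w        ≡⟨ fromNat-homo-+ w w ⟨
  fromNat (w ℕ.+ w)            ≤⟨ fromNat-mono-≤ 2w≤u+3 ⟩
  fromNat (u ℕ.+ 3)            ≡⟨ fromNat-homo-+ u 3 ⟩
  fromNat u + fromNat 3        ∎)
  where
  open ℚ.≤-Reasoning
  open ℚ.+-*-Solver

module HardInstance (k : ℕ) where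

  -- With n = `suc k`, all sizes lie strictly between 2ⁿ and 2ⁿ⁺¹, so any two items outweigh any
  -- single one; the terms 2ⁱ decide between pairs.
  s : Fin (suc k) → ℕ
  s i = 2 ^ suc k ℕ.+ 2 ^ toℕ i

  -- The offset keeps every value at least n, so a deficit of 3 is at most a fraction 3/n of the
  -- root's value.
  w : Fin (suc k) → ℕ
  w i = suc k ℕ.+ toℕ i

  I : Instance
  I = record
    { n                 = suc k
    ; value             = fromNat ∘ w
    ; size              = fromNat ∘ s
    ; value-nonNegative = λ _ → fromNat-mono-≤ ℕ.z≤n
    ; size-positive     = λ i → fromNat-mono-< (ℕ.<-≤-trans (ℕ.m^n>0 2 (suc k)) (ℕ.m≤m+n _ _))
    }

  open Instance I using (v; l)

  -- A certificate against every policy with root `r`. It is stated over ℕ to keep the arithmetic of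
  -- powers there; `theorem8` carries it over to ℚ.
  record Beaten (r : Fin (suc k)) : Set where
    field
      capacity worth : ℕ
      rival          : Subset (suc k)
      root-fits      : s r ℕ.≤ capacity
      root-alone     : ∀ j → capacity ℕ.< s j ℕ.+ s r
      rival-size     : l rival ≡ fromNat capacity
      rival-value    : v rival ≡ fromNat worth
      rival-wins     : w r ℕ.+ w r ℕ.≤ worth ℕ.+ 3

  -- Items 0 and 1 have no two items below them. The last item is worth 2n - 1 = 2(n + 1) - 3,
  -- exactly enough against item 1.
  beaten-by-last : ∀ r → toℕ r ℕ.≤ 1 → Beaten r
  beaten-by-last r r≤1 = record
    { capacity    = s (fromℕ k)
    ; rival       = ⁅ fromℕ k ⁆
    ; root-fits   = ℕ.+-monoʳ-≤ (2 ^ suc k) (ℕ.^-monoʳ-≤ 2 r≤last)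
    ; root-alone  = λ j → ℕ.+-mono-≤-< (ℕ.m≤m+n (2 ^ suc k) (2 ^ toℕ j)) (begin-strict
        2 ^ toℕ (fromℕ k)  <⟨ ℕ.^-monoʳ-< 2 ℕ.≤-refl (s≤s (ℕ.≤-reflexive (toℕ-fromℕ k))) ⟩
        2 ^ suc k          ≤⟨ ℕ.m≤m+n (2 ^ suc k) (2 ^ toℕ r) ⟩
        s r                ∎)
    ; rival-size  = total-⁅⁆ (fromNat ∘ s) (fromℕ k)
    ; rival-value = total-⁅⁆ (fromNat ∘ w) (fromℕ k)
    ; rival-wins  = begin
        w r ℕ.+ w r                      ≤⟨ ℕ.+-mono-≤ w≤ w≤ ⟩
        (suc k ℕ.+ 1) ℕ.+ (suc k ℕ.+ 1)
          ≡⟨ solve 1 (λ x → (con 1 :+ x :+ con 1) :+ (con 1 :+ x :+ con 1) := con 1 :+ x :+ x :+ con 3) refl k ⟩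
        suc k ℕ.+ k ℕ.+ 3                ≡⟨ cong (λ x → suc k ℕ.+ x ℕ.+ 3) (toℕ-fromℕ k) ⟨
        w (fromℕ k) ℕ.+ 3                ∎
    }
    where
    open ℕ.≤-Reasoning
    open +-*-Solver
    r≤last : toℕ r ℕ.≤ toℕ (fromℕ k)
    r≤last = subst (toℕ r ℕ.≤_) (sym (toℕ-fromℕ k)) (toℕ≤pred[n] r)
    w≤ : w r ℕ.≤ suc k ℕ.+ 1
    w≤ = ℕ.+-monoʳ-≤ (suc k) r≤1

  -- The positions come with equations so that rewriting turns all sizes and values into terms in
  -- `a`.
  beaten-by-pair : ∀ {a} r i j → toℕ r ≡ 2 ℕ.+ a → toℕ i ≡ a → toℕ j ≡ 1 ℕ.+ a → Beaten r
  beaten-by-pair {a} r i j r≡ i≡ j≡ = record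
    { capacity    = s i ℕ.+ s j
    ; rival       = ⁅ i ⁆ ∪ ⁅ j ⁆
    ; root-fits   = begin
        2 ^ suc k ℕ.+ 2 ^ toℕ r  ≤⟨ ℕ.+-monoʳ-≤ (2 ^ suc k) (ℕ.^-monoʳ-≤ 2 (ℕ.m≤n⇒m≤1+n (toℕ≤pred[n] r))) ⟩
        2 ^ suc k ℕ.+ 2 ^ suc k  ≤⟨ ℕ.+-mono-≤ (ℕ.m≤m+n (2 ^ suc k) (2 ^ toℕ i)) (ℕ.m≤m+n (2 ^ suc k) (2 ^ toℕ j)) ⟩
        s i ℕ.+ s j              ∎
    ; root-alone  = alone
    ; rival-size  = pair s
    ; rival-value = pair w
    ; rival-wins  = ℕ.≤-reflexive wins
    }
    where
    open ℕ.≤-Reasoning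
    open +-*-Solver
    i≢j : i ≢ j
    i≢j i≡j = ℕ.1+n≢n (trans (sym j≡) (trans (cong toℕ (sym i≡j)) i≡))
    pair : ∀ f → total (fromNat ∘ f) (⁅ i ⁆ ∪ ⁅ j ⁆) ≡ fromNat (f i ℕ.+ f j)
    pair f = trans (total-⁅⁆∪⁅⁆ (fromNat ∘ f) i≢j) (sym (fromNat-homo-+ (f i) (f j)))
    alone : ∀ h → s i ℕ.+ s j ℕ.< s h ℕ.+ s r
    alone h rewrite r≡ | i≡ | j≡ = begin-strict
      (M ℕ.+ A) ℕ.+ (M ℕ.+ 2 ℕ.* A)
        ≡⟨ solve 2 (λ m x → (m :+ x) :+ (m :+ con 2 :* x) := m :+ (m :+ con 3 :* x)) refl M A ⟩
      M ℕ.+ (M ℕ.+ 3 ℕ.* A)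
        -- The pair contributes 2ᵃ + 2ᵃ⁺¹ = 3 · 2ᵃ, the root 2ᵃ⁺² = 4 · 2ᵃ.
        ≤⟨ ℕ.+-mono-≤ (ℕ.≤-refl {M}) (ℕ.+-monoʳ-≤ M (ℕ.*-monoˡ-≤ A (ℕ.n≤1+n 3))) ⟩
      M ℕ.+ (M ℕ.+ 4 ℕ.* A)
        <⟨ ℕ.+-monoˡ-< (M ℕ.+ 4 ℕ.* A) (ℕ.m<m+n M (ℕ.m^n>0 2 (toℕ h))) ⟩
      s h ℕ.+ (M ℕ.+ 4 ℕ.* A)
        ≡⟨ cong (λ x → s h ℕ.+ (M ℕ.+ x)) (ℕ.*-assoc 2 2 A) ⟩
      s h ℕ.+ (M ℕ.+ 2 ℕ.* (2 ℕ.* A)) ∎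
      where
      M A : ℕ
      M = 2 ^ suc k
      A = 2 ^ a
    wins : w r ℕ.+ w r ≡ w i ℕ.+ w j ℕ.+ 3
    wins rewrite r≡ | i≡ | j≡ = solve 2 (λ m x →
      (m :+ (con 2 :+ x)) :+ (m :+ (con 2 :+ x)) := (m :+ x) :+ (m :+ (con 1 :+ x)) :+ con 3) refl (suc k) a

beaten : ∀ k r → HardInstance.Beaten k r
beaten k zero = HardInstance.beaten-by-last k zero ℕ.z≤n
beaten (suc k) (suc zero) = HardInstance.beaten-by-last (suc k) (suc zero) ℕ.≤-refl
beaten (suc k) (suc (suc {suc _} r)) = HardInstance.beaten-by-pair (suc k) (suc (suc r))
  -- `inject₁` preserves `toℕ`, so these are the two items just below the root.
  (inject₁ (inject₁ r)) (inject₁ (suc r)) refl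
  (trans (toℕ-inject₁ (inject₁ r)) (toℕ-inject₁ r)) (cong suc (toℕ-inject₁ r))

theorem8 : (δ : ℚ) → 0ℚ < δ → Σ[ I ∈ Instance ] ((P : Policy (Instance.n I)) → ¬ Robust I (+ 2 / 1 - δ) P)
-- Here 3 is the slack in `rival-wins`, and with `suc k` items every value exceeds the threshold
-- `k`.
theorem8 δ 0<δ with archimedean δ 0<δ 3
... | k , large = I , not-robust
  where
  open HardInstance k
  not-robust : (P : Policy (suc k)) → ¬ Robust I (+ 2 / 1 - δ) P
  not-robust P robust with packing-root I zero P
  ... | r , packs =
    no-factor δ worth (w r) rival-wins (large (w r) (ℕ.≤-trans (ℕ.n≤1+n k) (ℕ.m≤m+n (suc k) (toℕ r))))
      (subst (_≤ (+ 2 / 1 - δ) * fromNat (w r)) rival-value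
        (robust-bound I {+ 2 / 1 - δ} {P} rival robust (fromNat-mono-≤ ℕ.z≤n)
          (packs (fromNat capacity) (fromNat-mono-≤ root-fits)
            (λ j _ → subst (fromNat capacity <_) (fromNat-homo-+ (s j) (s r)) (fromNat-mono-< (root-alone j))))
          (ℚ.≤-reflexive rival-size)))
    where open Beaten (beaten k r)
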